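{- Let $(X,E)$ be an undirected simple graph with finite vertex set $X$, let $Y$ be a finite set and let $F:X\to 2^Y$ be a set-valued mapping. For Calculation Method 2 applied to $F$, with largest occurring index $i^{max}_2$, the following statements are equivalent: (i) $F$ admits a disparate selection. (ii) Calculation Method 2 does not stop at Step 3. (iii) Calculation Method 2 stops at Step 5. (iv) $i^{max}_2=\sharp X$ and a disparate selection $s$ of $F$ is given by $s(x_i)=y_i$ for $i=1,\dots,i^{max}_2$ (where $(x_i,y_i)$ are the points chosen in Step 4).
   Context: Setting. $(X,E)$ is an undirected simple graph with finite vertex set $X$, $Y$ is a finite set, $F:X\to 2^Y$ is a set-valued mapping (nonempty images are not required as a general condition). $\sharp$ denotes cardinality; $\subset$ allows equality. $G(F)=\{(x,y)\in X\times Y\mid y\in F(x)\}$ is the graph of $F$; $F_{|W}$ is the restriction of $F$ to $W\subset X$. A submapping of $F$ is a set-valued mapping $F'$ on the same domain with $G(F')\subset G(F)$. A selection of $F$ is a map $s:X\to Y$ with $s(x)\in F(x)$ for all $x\in X$. Disparate. Points $(x,y),(x',y')\in X\times Y$ are disparate if $(x,y)\ne(x',y')$ and ($y=y'$ implies $\{x,x'\}\notin E$). A set $A\subset X\times Y$ is disparate if any two distinct points of $A$ are disparate. A selection $s$ is disparate if $G(s)=\{(x,s(x))\mid x\in X\}$ is a disparate set. For $A\subset X\times Y$: $hull(A)=\{a\in X\times Y\mid$ there is $a'\in A$ such that $a,a'$ are not disparate$\}$ and $compl(A)=\{a\in X\times Y\mid a,a'$ are disparate for every $a'\in A\}$. Complement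 mapping. For $W\subset X$ and $Z\subset W\times Y$, $F_{W,Z}:X\setminus W\to 2^Y$ is defined by $G(F_{W,Z})=G(F_{|X\setminus W})\cap compl(Z)$. Convention. For a mapping defined on a subset $X'\subset X$, all notions are understood with $X'$ and the subgraph of $(X,E)$ induced by $X'$ in place of $X$ and $(X,E)$. Collections. A collection of $F$ is a family $\mathcal H=(A_V)$ indexed by the nonempty sets $V\subset X$, with $A_V\subset G(F_{|V})$. It is a Hall collection if every $A_V$ is disparate and $\sharp A_V\ge\sharp V$. For $W\subset X$, $\mathcal H_{|W}$ is the family of the $A_V$ with $\emptyset\ne V\subset W$ (a collection of $F_{|W}$), and $\mathcal H_W$ is the family, indexed by the nonempty $V\subset X\setminus W$, of the sets $A_{W\cup V}\cap compl(\bigcup_{A\in\mathcal H_{|W}}A)\cap(V\times Y)$ (a collection of $F_{|X\setminus W}$). For nonempty $W$, $F^{\mathcal H_W}$ is the submapping of $F_{|W}$ with graph $G(F_{|W})\cap compl(\bigcup_{A\in\mathcal H_W}A)$. For nonempty $W$, $\mathcal H$ is $W$-distributed if for every nonempty $V\subset X\setminus W$, $$\sharp\Bigl(A_{W\cup V}\cap\bigl((W\times Y)\cup(hull(\textstyle\bigcup_{A\in\mathcal H_{|W}}A)\cap(V\times Y))\bigr)\Bigr)\le\sharp W .$$ Cascades. For a tuple $(W_1,\dots,W_k)$, $k\ge1$, of subsets of $W_0=X$ put $W_0^c=W_0$ and, for $i=1,\dots,k$, $W_i^c=W_{i-1}\setminus W_i$ if $W_i\subset W_{i-1}$, and $W_i^c=W_{i-1}^c\setminus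 W_i$ otherwise. The tuple is a cascade in $X$ if $W_i\subset W_{i-1}$ or $W_i\subset W_{i-1}^c$ for $i=1,\dots,k$. Put $pre(i)=W_{i-1}$ if $W_i\subset W_{i-1}$ and $pre(i)=W_{i-1}^c$ if $W_i\subset W_{i-1}^c$. Given a collection $\mathcal H$ of $F$ and a cascade, put $\mathcal H(W_1,\dots,W_0)=\mathcal H$, $F(W_1,\dots,W_0)=F$ and inductively for $i=1,\dots,k-1$, writing $\mathcal H'=\mathcal H(W_1,\dots,W_{i-1})$, $F'=F(W_1,\dots,W_{i-1})$ and $\tilde F=F'^{\,\mathcal H'_{W_i}}$: if $W_{i+1}\subset W_i$, then $\mathcal H(W_1,\dots,W_i)=\mathcal H'_{|W_i}$ and $F(W_1,\dots,W_i)=\tilde F$; if $W_{i+1}\subset W_i^c$, then $\mathcal H(W_1,\dots,W_i)=\mathcal H'_{W_i}$ and $F(W_1,\dots,W_i)=F'_{W_i,G(\tilde F)}$. Here $F(W_1,\dots,W_{i-1})$ is a mapping on $pre(i)$ and $\mathcal H(W_1,\dots,W_{i-1})$ is a collection of it. Generalized Hall condition (recursion on $\sharp X\ge 1$). If $\sharp X=1$, $F$ satisfies it if $G(F)\ne\emptyset$. Let $\sharp X>1$ and suppose the condition is defined for mappings on smaller vertex sets. - A nonempty $W\subset X$ is a generalized critical set of $F$ if there is $(x,y)\in(X\setminus W)\times Y$ such that $(F_{\{x\},\{(x,y)\}})_{|W}$ does not satisfy the generalized Hall condition. It is minimal if no proper subset of $W$ is a generalized critical set of $F$. - For a Hall collection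 $\mathcal H$ of $F$, a cascade $(W_1,\dots,W_k)$ in $X$ is a primitive $(F,\mathcal H)$-critical cascade if $W_i$ is a minimal generalized critical set of $F(W_1,\dots,W_{i-1})$ for $i=1,\dots,k$. - A Hall collection $\mathcal H$ of $F$ is distributed if for each primitive $(F,\mathcal H)$-critical cascade $(W_1,\dots,W_k)$ in $X$ the collection $\mathcal H(W_1,\dots,W_{i-1})$ of $F(W_1,\dots,W_{i-1})$ is $W_i$-distributed for $i=1,\dots,k$. - $F$ satisfies the generalized Hall condition if $F$ admits a distributed Hall collection. Disparate kernel. $F^*$ is the submapping of $F$ with $F^*(x)=\{y\in F(x)\mid$ there is a disparate selection $s$ of $F$ with $s(x)=y\}$. Elimination. For nonempty $W\subset X$, $elim_F(W)$ is the set of all $(x,y)\in G(F_{|X\setminus W})$ such that $(F_{\{x\},\{(x,y)\}})_{|W}$ does not satisfy the generalized Hall condition. A nonempty $W\subset X$ is an elimination set of $F$ if $elim_F(W)\ne\emptyset$. Calculation Method 1 (applied to a mapping $P$ on a vertex set $X'$). Step 1: set $P^1=P$ and $j=1$. Step 2: choose an elimination set $W\subset X'$ of $P^j$. Step 3: if $P^j$ does not admit an elimination set, STOP; otherwise continue. Step 4: define $P^{j+1}$ by $G(P^{j+1})=G(P^j)\setminus elim_{P^j}(W)$. Step 5: if $P^{j+1}(x)=\emptyset$ for some $x\in X'$, STOP; otherwise continue. Step 6: increase $j$ to $j+1$ and continue with Step 2. The method always terminates. If $G(P)\ne\emptyset$ and it stops at Step 3, its final mapping is $P^*$; if $G(P)\neq\emptyset$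 and it stops at Step 5, $P$ admits no disparate selection. Calculation Method 2. Step 1: set $F^1=F$ and $i=1$. Step 2: determine the disparate kernel $(F^i)^*$ of $F^i$ with Calculation Method 1. Step 3: if Calculation Method 1 terminates at its Step 5, STOP; otherwise continue. Step 4: choose $(x_i,y_i)\in G((F^i)^*)$. Step 5: if $i=\sharp X$, STOP; otherwise continue. Step 6: set $F^{i+1}=((F^i)^*)_{\{x_i\},\{(x_i,y_i)\}}$ (a mapping on $X\setminus\{x_1,\dots,x_i\}$), increase $i$ to $i+1$ and continue with Step 2. The method terminates after finitely many steps; $i^{max}_2$ denotes the largest value of the index $i$ which occurs. -}

module Defs where

open import Level using (0ℓ)
open import Data.Nat using (ℕ; zero; suc; _≤_; _<_)
open import Data.Nat.Properties using (+-0-commutativeMonoid)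
open import Data.Fin using (Fin)
open import Data.Fin.Properties using (all?; any?) renaming (_≟_ to _≟ᶠ_)
open import Data.Fin.Subset
  using (Subset; ⊤; ⊥; ⁅_⁆; _∈_; _⊆_; _⊂_; _∩_; _∪_; _─_; ∣_∣; Nonempty; Empty)
open import Data.Fin.Subset.Properties using (_∈?_; _⊆?_; anySubset?; nonempty?)
open import Data.Bool using (if_then_else_)
open import Data.List using (List; []; _∷_)
open import Data.List.Relation.Unary.All using (All)
open import Data.Product using (_×_; _,_; proj₁; proj₂; ∃; ∃-syntax; Σ-syntax)
open import Data.Product.Properties using (≡-dec)
open import Data.Sum using (_⊎_)
open import Data.Unit using () renaming (⊤ to True)
open import Data.Empty using () renaming (⊥ to False)
import Data.Vec as Vec
open import Function.Bundles using (_⇔_)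
open import Relation.Nullary using (¬_; Dec; does; ¬?)
open import Relation.Nullary.Decidable using (_×-dec_; _→-dec_)
open import Relation.Unary using (Pred) renaming (Decidable to Decidable₁; _⊆_ to _⊆ᵖ_)
open import Relation.Binary using (Rel; Symmetric; Irreflexive; Decidable)
open import Relation.Binary.PropositionalEquality using (_≡_; _≢_)
open import Algebra.Properties.CommutativeMonoid.Sum +-0-commutativeMonoid using (sum)

-- Undirected simple graph on X = Fin n.  Decidability of adjacency is
-- automatic for a finite graph in classical mathematics.
record SimpleGraph (n : ℕ) : Set₁ where
  field
    Edge   : Rel (Fin n) 0ℓ
    edge?  : Decidable Edge
    symm   : Symmetric Edge
    irrefl : Irreflexive _≡_ Edge

private
  variable
    n m : ℕ

Point : ℕ → ℕ → Set
Point n m = Fin n × Fin m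

-- A set A ⊂ X × Y is encoded by its fibres A x = { y | (x , y) ∈ A }.
PointSet : ℕ → ℕ → Set
PointSet n m = Fin n → Subset m

⟦_⟧ : PointSet n m → Pred (Point n m) 0ℓ
⟦ A ⟧ (x , y) = y ∈ A x

comprehension : {P : Pred (Point n m) 0ℓ} → Decidable₁ P → PointSet n m
comprehension P? x = Vec.tabulate λ y → does (P? (x , y))

♯ : PointSet n m → ℕ
♯ A = sum λ x → ∣ A x ∣

infixr 7 _∩ᵖ_
infixr 6 _∪ᵖ_

_∩ᵖ_ _∪ᵖ_ : PointSet n m → PointSet n m → PointSet n m
(A ∩ᵖ B) x = A x ∩ B x
(A ∪ᵖ B) x = A x ∪ B x

_×Y : Subset n → PointSet n m
(W ×Y) x = if does (x ∈? W) then ⊤ else ⊥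

point : Point n m → PointSet n m
point p = comprehension λ q → ≡-dec _≟ᶠ_ _≟ᶠ_ q p

-- A set-valued mapping dom → 2^Y with dom ⊂ X; the values of val outside
-- dom carry no meaning, so every notion below refers to graph only.
record Mapping (n m : ℕ) : Set where
  constructor mapping
  field
    dom : Subset n
    val : Fin n → Subset m

open Mapping

total : (Fin n → Subset m) → Mapping n m
total F = mapping ⊤ F

graph : Mapping n m → PointSet n m
graph F = val F ∩ᵖ (dom F ×Y)

-- Used for W ⊂ dom F only.
restrict : Mapping n m → Subset n → Mapping n m
restrict F W = mapping W (val F)

-- A collection (A_V) of a mapping on D; only the A_V with ∅ ≠ V ⊂ D matter,
-- and D is supplied wherever the index range plays a role.  Hence H also
-- stands for its own restriction H_{|W}.
Family : ℕ → ℕ → Set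
Family n m = Subset n → PointSet n m

⋃⟨_⟩ : Subset n → Family n m → PointSet n m
⋃⟨ D ⟩ H = comprehension λ (x , y) →
  anySubset? λ V → nonempty? V ×-dec (V ⊆? D) ×-dec (y ∈? H V x)

-- The pairs (W_i^c) of a cascade: next (W_{i-1} , W_{i-1}^c) W_i = W_i^c.
nextComplement : Subset n → Subset n → Subset n → Subset n
nextComplement W Wᶜ W′ = if does (W′ ⊆? W) then W ─ W′ else Wᶜ ─ W′

CascadeFrom : Subset n → Subset n → List (Subset n) → Set
CascadeFrom W Wᶜ []        = True
CascadeFrom W Wᶜ (W′ ∷ Ws) =
  (W′ ⊆ W ⊎ W′ ⊆ Wᶜ) × CascadeFrom W′ (nextComplement W Wᶜ W′) Ws

IsCascade : Subset n → List (Subset n) → Set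
IsCascade D Ws = CascadeFrom D D Ws

-- W_i together with F(W_1,…,W_{i-1}) and H(W_1,…,W_{i-1}).
record Stage (n m : ℕ) : Set where
  constructor stage
  field
    set : Subset n
    map : Mapping n m
    col : Family n m

open Stage

data Outcome (n m : ℕ) : Set where
  atStep3 : (final : Mapping n m) → Outcome n m
  atStep5 : Outcome n m

module _ (Γ : SimpleGraph n) where

  open SimpleGraph Γ

  Disparate : Point n m → Point n m → Set
  Disparate (x , y) (x′ , y′) = (x , y) ≢ (x′ , y′) × (y ≡ y′ → ¬ Edge x x′)

  disparate? : (a b : Point n m) → Dec (Disparate a b)
  disparate? (x , y) (x′ , y′) =
    ¬? (≡-dec _≟ᶠ_ _≟ᶠ_ (x , y) (x′ , y′)) ×-dec ((y ≟ᶠ y′) →-dec ¬? (edge? x x′))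

  IsDisparate : Pred (Point n m) 0ℓ → Set
  IsDisparate A = ∀ a b → A a → A b → a ≢ b → Disparate a b

  IsSelection : (Fin n → Subset m) → (Fin n → Fin m) → Set
  IsSelection F s = ∀ x → s x ∈ F x

  IsDisparateSelection : (Fin n → Subset m) → (Fin n → Fin m) → Set
  IsDisparateSelection F s = IsSelection F s × IsDisparate (λ (x , y) → y ≡ s x)

  hull : PointSet n m → PointSet n m
  hull A = comprehension λ a →
    any? λ x′ → any? λ y′ → (y′ ∈? A x′) ×-dec ¬? (disparate? a (x′ , y′))

  compl : PointSet n m → PointSet n m
  compl A = comprehension λ a →
    all? λ x′ → all? λ y′ → (y′ ∈? A x′) →-dec disparate? a (x′ , y′)

  -- F_{W,Z}
  complementMapping : Mapping n m → Subset n → PointSet n m → Mapping n m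
  complementMapping F W Z = mapping (dom F ─ W) (val F ∩ᵖ compl Z)

  -- F_{{x},{(x,y)}}
  fix : Mapping n m → Point n m → Mapping n m
  fix F p = complementMapping F ⁅ proj₁ p ⁆ (point p)

  -- H_W
  complementFamily : Family n m → Subset n → Family n m
  complementFamily H W V = H (W ∪ V) ∩ᵖ compl (⋃⟨ W ⟩ H) ∩ᵖ (V ×Y)

  -- F^{H_W}
  kept : Mapping n m → Family n m → Subset n → Mapping n m
  kept F H W =
    mapping W (val F ∩ᵖ compl (⋃⟨ dom F ─ W ⟩ (complementFamily H W)))

  record IsHallCollection (F : Mapping n m) (H : Family n m) : Set where
    field
      inGraph   : ∀ V → Nonempty V → V ⊆ dom F → ⟦ H V ⟧ ⊆ᵖ ⟦ graph (restrict F V) ⟧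
      disparate : ∀ V → Nonempty V → V ⊆ dom F → IsDisparate ⟦ H V ⟧
      large     : ∀ V → Nonempty V → V ⊆ dom F → ∣ V ∣ ≤ ♯ (H V)

  -- The collection H on D is W-distributed.
  IsDistributedAt : Subset n → Family n m → Subset n → Set
  IsDistributedAt D H W = ∀ V → Nonempty V → V ⊆ D ─ W →
    ♯ (H (W ∪ V) ∩ᵖ ((W ×Y) ∪ᵖ (hull (⋃⟨ W ⟩ H) ∩ᵖ (V ×Y)))) ≤ ∣ W ∣

  -- The stages i = 1,…,k of a cascade (W_1,…,W_k), starting from F and H.
  -- The domain of the current mapping is pre(i), and pre(i) \ W_i = W_i^c in
  -- both cases of its definition; so for a cascade W′ ⊄ W means W′ ⊂ W^c.
  -- The branches overlap for W′ = ∅ only, which is never a critical set.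
  stages : Mapping n m → Family n m → List (Subset n) → List (Stage n m)
  stages F H []            = []
  stages F H (W ∷ [])      = stage W F H ∷ []
  stages F H (W ∷ W′ ∷ Ws) = stage W F H ∷
    (if does (W′ ⊆? W)
     then stages (kept F H W) H (W′ ∷ Ws)
     else stages (complementMapping F W (graph (kept F H W)))
                 (complementFamily H W) (W′ ∷ Ws))

  -- The notions entering the recursive step, relative to a predicate Hall
  -- playing the role of the generalized Hall condition for mappings on
  -- smaller vertex sets.
  module _ (Hall : Mapping n m → Set) where

    IsCritical : Mapping n m → Subset n → Set
    IsCritical F W = Nonempty W × W ⊆ dom F ×
      ∃[ x ] ∃[ y ] (x ∈ dom F ─ W × ¬ Hall (restrict (fix F (x , y)) W))

    IsMinimalCritical : Mapping n m → Subset n → Set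
    IsMinimalCritical F W =
      IsCritical F W × (∀ W′ → W′ ⊂ W → ¬ IsCritical F W′)

    IsPrimitiveCritical : Mapping n m → Family n m → List (Subset n) → Set
    IsPrimitiveCritical F H Ws = IsCascade (dom F) Ws ×
      All (λ σ → IsMinimalCritical (map σ) (set σ)) (stages F H Ws)

    IsDistributed : Mapping n m → Family n m → Set
    IsDistributed F H = ∀ W Ws → IsPrimitiveCritical F H (W ∷ Ws) →
      All (λ σ → IsDistributedAt (dom (map σ)) (col σ) (set σ))
          (stages F H (W ∷ Ws))

  -- Recursion on the size of the vertex set.  The first argument is fuel
  -- bounding that size: a mapping on at most k + 1 vertices only calls the
  -- condition on proper subsets of its vertex set, i.e. on at most k vertices.
  HallUpTo : ℕ → Mapping n m → Set
  HallUpTo zero    F = False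
  HallUpTo (suc k) F =
      (∣ dom F ∣ ≡ 1 × ∃ ⟦ graph F ⟧)
    ⊎ (1 < ∣ dom F ∣ ×
       ∃[ H ] (IsHallCollection F H × IsDistributed (HallUpTo k) F H))

  GeneralizedHall : Mapping n m → Set
  GeneralizedHall F = HallUpTo ∣ dom F ∣ F

  elim : Mapping n m → Subset n → Pred (Point n m) 0ℓ
  elim F W (x , y) = ⟦ graph (restrict F (dom F ─ W)) ⟧ (x , y) ×
                     ¬ GeneralizedHall (restrict (fix F (x , y)) W)

  IsEliminationSet : Mapping n m → Subset n → Set
  IsEliminationSet F W = Nonempty W × W ⊆ dom F × ∃ (elim F W)

  -- G(Q) = G(P) \ elim_P(W), as mappings on the same vertex set.
  IsElimination : Mapping n m → Subset n → Mapping n m → Set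
  IsElimination P W Q = dom Q ≡ dom P ×
    (∀ p → ⟦ graph Q ⟧ p ⇔ (⟦ graph P ⟧ p × ¬ elim P W p))

  -- Method1 P o: a terminated run of Calculation Method 1 on P with outcome o,
  -- for some choices of elimination sets in its Step 2.
  data Method1 {m} (P : Mapping n m) : Outcome n m → Set where
    stop3 : ¬ (∃[ W ] IsEliminationSet P W) → Method1 P (atStep3 P)
    stop5 : ∀ W Q → IsEliminationSet P W → IsElimination P W Q →
            (∃[ x ] (x ∈ dom Q × Empty (val Q x))) → Method1 P atStep5
    loop  : ∀ W Q {o} → IsEliminationSet P W → IsElimination P W Q →
            ¬ (∃[ x ] (x ∈ dom Q × Empty (val Q x))) →
            Method1 Q o → Method1 P o

  -- Method2From i Fⁱ: a terminated run of Calculation Method 2 from its Step 2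
  -- on, for some choices in its Step 4.  The kernel (Fⁱ)* is used in the form in
  -- which Step 2 determines it, as the final mapping K of Calculation Method 1;
  -- that K has the graph of the disparate kernel is not assumed.
  data Method2From {m} (i : ℕ) (Fⁱ : Mapping n m) : Set where
    stop3 : Method1 Fⁱ atStep5 → Method2From i Fⁱ
    stop5 : ∀ K p → Method1 Fⁱ (atStep3 K) → ⟦ graph K ⟧ p →
            i ≡ n → Method2From i Fⁱ
    loop  : ∀ K p → Method1 Fⁱ (atStep3 K) → ⟦ graph K ⟧ p →
            i ≢ n → Method2From (suc i) (fix K p) → Method2From i Fⁱ

  StopsAtStep3 StopsAtStep5 : ∀ {i} {Fⁱ : Mapping n m} → Method2From i Fⁱ → Set
  StopsAtStep3 (stop3 _)          = True
  StopsAtStep3 (stop5 _ _ _ _ _)  = False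
  StopsAtStep3 (loop _ _ _ _ _ r) = StopsAtStep3 r
  StopsAtStep5 (stop3 _)          = False
  StopsAtStep5 (stop5 _ _ _ _ _)  = True
  StopsAtStep5 (loop _ _ _ _ _ r) = StopsAtStep5 r

  iMax : ∀ {i} {Fⁱ : Mapping n m} → Method2From i Fⁱ → ℕ
  iMax {i = i} (stop3 _)          = i
  iMax {i = i} (stop5 _ _ _ _ _)  = i
  iMax         (loop _ _ _ _ _ r) = iMax r

  -- The points (x_i , y_i) chosen in Step 4, in order.
  chosen : ∀ {i} {Fⁱ : Mapping n m} → Method2From i Fⁱ → List (Point n m)
  chosen (stop3 _)          = []
  chosen (stop5 _ p _ _ _)  = p ∷ []
  chosen (loop _ p _ _ _ r) = p ∷ chosen r

  Method2 : (Fin n → Subset m) → Set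
  Method2 F = Method2From 1 (total F)

{-# OPTIONS --safe #-}
module Submission where

-- The generalized Hall condition is equivalent to the existence of a disparate
-- selection, and the theorem rests on both directions of this equivalence.
--
-- Necessity (selection⇒hall).  The traces S ∩ (V × Y) of the graph S of a disparate
-- selection form a Hall collection.  All collections arising from it along a
-- cascade still consist of subsets of S, and such a collection is distributed:
-- points of S outside W are never in the hull of points of S over W.
--
-- Sufficiency (hall⇒selectable), by induction on the vertex set as in the proof of
-- Hall's theorem by Halmos and Vaughan.  Given a distributed Hall collection H of
-- F, suppose that there is a minimal critical set W.  Then H restricted to W and
-- H_W are distributed Hall collections of F^{H_W} on W and of the complementary
-- mapping on X minus W; the count for H_W is exactly W-distributedness, and a
-- critical cascade of either half becomes one of F when W is put in front.  By
-- induction both mappings have disparate selections, and these are disparate from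
-- each other.  If there is no minimal critical set, there is no critical set at
-- all, so any point (x , y) of the graph of F may be fixed and completed on X minus x.
-- The argument does not decide whether there is a critical set, so it yields a
-- selection only up to double negation; this suffices because it is used only to
-- refute a stop at Step 3.
--
-- By necessity, Calculation Method 1 never removes a point of a disparate
-- selection.  Hence it cannot stop at its Step 5 on a mapping that has one.  By
-- sufficiency, each point of a mapping without elimination sets extends to a
-- disparate selection, so Calculation Method 2 never stops at Step 3 after a point
-- has been chosen; if F has a disparate selection, it does not stop there before
-- either.  Conversely, the points chosen in a run that stops at Step 5 have distinct
-- vertices and are disparate by construction, and there is one for each vertex
-- since each round removes one vertex.

open import Defs
open import Data.Nat using (ℕ; zero; suc; _+_; _≤_; z≤n; s≤s)
open import Data.Nat.Properties
  using ( ≤-refl; ≤-reflexive; ≤-trans; <-≤-trans; <⇒≱; ≤-pred; ≤∧≢⇒<; +-mono-≤; +-monoˡ-≤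
        ; +-cancelˡ-≤; +-cancelʳ-≤; +-suc; +-comm; m≤n⇒m≤1+n; _≟_
        ; +-commutativeSemigroup; module ≤-Reasoning )
open import Data.Fin using (Fin; zero; suc)
open import Data.Fin.Properties using (all?; any?) renaming (_≟_ to _≟ᶠ_)
open import Data.Fin.Subset
  using (Subset; inside; outside; ⊥; ⁅_⁆; _⊆_; _⊂_; _∪_; _─_; ∣_∣; Nonempty; Empty)
  renaming (_∈_ to _∈ˢ_; _∉_ to _∉ˢ_)
open import Data.Fin.Subset.Properties
  using ( _∈?_; _⊆?_; nonempty?; anySubset?; ∈⊤; ∉⊥; x∈⁅x⁆; x∈⁅y⁆⇒x≡y; ∣⁅x⁆∣≡1; ∣⊥∣≡0; ∣⊤∣≡n
        ; p⊆q⇒∣p∣≤∣q∣; p⊂q⇒∣p∣<∣q∣; x∈p∩q⁺; x∈p∩q⁻; x∈p∪q⁺; x∈p∪q⁻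
        ; p─q⊆p; x∈p∧x∉q⇒x∈p─q; p∩q≢∅⇒p─q⊂p; drop-there )
open import Data.Fin.Subset.Induction using (⊂-wellFounded; Acc; acc)
open import Data.Bool using (if_then_else_)
open import Data.List using (List; []; _∷_; foldr)
open import Data.List.Membership.Propositional using (_∈_)
open import Data.List.Relation.Unary.All as All using (All; []; _∷_)
open import Data.List.Relation.Unary.Any using (here; there)
open import Data.Product using (_×_; _,_; proj₁; proj₂; ∃; ∃-syntax)
open import Data.Product.Properties using (≡-dec)
open import Data.Sum using (_⊎_; inj₁; inj₂; [_,_]; reduce)
open import Data.Unit using (tt)
open import Data.Vec using ([]; _∷_; here; there)
open import Data.Vec.Properties using (lookup∘tabulate; []=⇒lookup; lookup⇒[]=)
open import Function using (_∘_; _$_)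
open import Function.Bundles using (_⇔_; mk⇔; module Equivalence)
open import Relation.Binary.PropositionalEquality
  using (_≡_; _≢_; refl; sym; trans; cong; subst)
open import Relation.Nullary using (¬_; Dec; yes; no; ¬?; contradiction)
open import Relation.Nullary.Decidable using (dec-true; dec-false; _×-dec_; _→-dec_)
open import Relation.Unary using (Pred) renaming (Decidable to Decidable₁; _⊆_ to _⊆ᵖ_)
open import Level using (0ℓ)
open import Algebra.Properties.CommutativeSemigroup +-commutativeSemigroup using (interchange)

open Mapping

private
  variable
    n m : ℕ

-- Finite sets and their cardinalities

x∈p─q⇒x∉q : ∀ {x} (p q : Subset n) → x ∈ˢ p ─ q → x ∉ˢ q
x∈p─q⇒x∉q (inside  ∷ p) (outside ∷ q) here ()
x∈p─q⇒x∉q (_ ∷ p) (_ ∷ q) (there x∈p─q) (there x∈q) = x∈p─q⇒x∉q p q x∈p─q x∈q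

∣p∪q∣≤∣p∣+∣q∣ : (p q : Subset n) → ∣ p ∪ q ∣ ≤ ∣ p ∣ + ∣ q ∣
∣p∪q∣≤∣p∣+∣q∣ []            []            = z≤n
∣p∪q∣≤∣p∣+∣q∣ (outside ∷ p) (outside ∷ q) = ∣p∪q∣≤∣p∣+∣q∣ p q
∣p∪q∣≤∣p∣+∣q∣ (outside ∷ p) (inside  ∷ q) =
  ≤-trans (s≤s (∣p∪q∣≤∣p∣+∣q∣ p q)) (≤-reflexive (sym (+-suc _ _)))
∣p∪q∣≤∣p∣+∣q∣ (inside  ∷ p) (outside ∷ q) = s≤s (∣p∪q∣≤∣p∣+∣q∣ p q)
∣p∪q∣≤∣p∣+∣q∣ (inside  ∷ p) (inside  ∷ q) =
  s≤s (≤-trans (m≤n⇒m≤1+n (∣p∪q∣≤∣p∣+∣q∣ p q)) (≤-reflexive (sym (+-suc _ _))))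

∣p∣+∣q∣≤∣p∪q∣ : (p q : Subset n) → (∀ {x} → x ∈ˢ p → x ∉ˢ q) → ∣ p ∣ + ∣ q ∣ ≤ ∣ p ∪ q ∣
∣p∣+∣q∣≤∣p∪q∣ []            []            disj = z≤n
∣p∣+∣q∣≤∣p∪q∣ (outside ∷ p) (outside ∷ q) disj =
  ∣p∣+∣q∣≤∣p∪q∣ p q λ x∈p x∈q → disj (there x∈p) (there x∈q)
∣p∣+∣q∣≤∣p∪q∣ (outside ∷ p) (inside  ∷ q) disj =
  ≤-trans (≤-reflexive (+-suc _ _))
          (s≤s (∣p∣+∣q∣≤∣p∪q∣ p q λ x∈p x∈q → disj (there x∈p) (there x∈q)))
∣p∣+∣q∣≤∣p∪q∣ (inside  ∷ p) (outside ∷ q) disj =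
  s≤s (∣p∣+∣q∣≤∣p∪q∣ p q λ x∈p x∈q → disj (there x∈p) (there x∈q))
∣p∣+∣q∣≤∣p∪q∣ (inside  ∷ p) (inside  ∷ q) disj = contradiction here (disj here)

nonempty⇒1≤∣p∣ : {p : Subset n} → Nonempty p → 1 ≤ ∣ p ∣
nonempty⇒1≤∣p∣ {p = p} (x , x∈p) = subst (_≤ ∣ p ∣) (∣⁅x⁆∣≡1 x)
  (p⊆q⇒∣p∣≤∣q∣ λ z∈ → subst (_∈ˢ p) (sym (x∈⁅y⁆⇒x≡y x z∈)) x∈p)

empty⇒∣p∣≤0 : {p : Subset n} → Empty p → ∣ p ∣ ≤ 0
empty⇒∣p∣≤0 {n} {p} ¬ne = subst (∣ p ∣ ≤_) (∣⊥∣≡0 n)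
  (p⊆q⇒∣p∣≤∣q∣ {q = ⊥} λ x∈p → contradiction (_ , x∈p) ¬ne)

subsingleton⇒∣p∣≤1 : {p : Subset n} → (∀ {x y} → x ∈ˢ p → y ∈ˢ p → x ≡ y) → ∣ p ∣ ≤ 1
subsingleton⇒∣p∣≤1 {p = p} unique with nonempty? p
... | no ¬ne        = ≤-trans (empty⇒∣p∣≤0 ¬ne) z≤n
... | yes (x , x∈p) = subst (∣ p ∣ ≤_) (∣⁅x⁆∣≡1 x)
  (p⊆q⇒∣p∣≤∣q∣ λ z∈p → subst (_∈ˢ ⁅ x ⁆) (unique x∈p z∈p) (x∈⁅x⁆ x))

x∈p─⁅y⁆⇒x≢y : ∀ {x y} (p : Subset n) → x ∈ˢ p ─ ⁅ y ⁆ → x ≢ y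
x∈p─⁅y⁆⇒x≢y p x∈ refl = x∈p─q⇒x∉q p _ x∈ (x∈⁅x⁆ _)

p─⁅x⁆⊂p : ∀ {x} (p : Subset n) → x ∈ˢ p → p ─ ⁅ x ⁆ ⊂ p
p─⁅x⁆⊂p p x∈p = p∩q≢∅⇒p─q⊂p p ⁅ _ ⁆ (_ , x∈p∩q⁺ (x∈p , x∈⁅x⁆ _))

∣p∣≤1⇒p─⁅x⁆-empty : ∀ {x} (p : Subset n) → ∣ p ∣ ≤ 1 → x ∈ˢ p → Empty (p ─ ⁅ x ⁆)
∣p∣≤1⇒p─⁅x⁆-empty p ∣p∣≤1 x∈p ne =
  <⇒≱ (<-≤-trans (p⊂q⇒∣p∣<∣q∣ (p─⁅x⁆⊂p p x∈p)) ∣p∣≤1) (nonempty⇒1≤∣p∣ ne)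

x∈p⇒x∈p─[p─⁅x⁆] : ∀ {x} (p : Subset n) → x ∈ˢ p → x ∈ˢ p ─ (p ─ ⁅ x ⁆)
x∈p⇒x∈p─[p─⁅x⁆] p x∈p = x∈p∧x∉q⇒x∈p─q x∈p λ x∈ → x∈p─⁅y⁆⇒x≢y p x∈ refl

-- Sets of points

∈comprehension⁺ : {P : Pred (Point n m) 0ℓ} (P? : Decidable₁ P) → P ⊆ᵖ ⟦ comprehension P? ⟧
∈comprehension⁺ P? {x , y} pxy =
  lookup⇒[]= y _ (trans (lookup∘tabulate _ y) (dec-true (P? (x , y)) pxy))

∈comprehension⁻ : {P : Pred (Point n m) 0ℓ} (P? : Decidable₁ P) → ⟦ comprehension P? ⟧ ⊆ᵖ P
∈comprehension⁻ P? {x , y} y∈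
  with P? (x , y) | trans (sym (lookup∘tabulate _ y)) ([]=⇒lookup y∈)
... | yes pxy | _ = pxy

∈point⁺ : (p : Point n m) → ⟦ point p ⟧ p
∈point⁺ p = ∈comprehension⁺ (λ q → ≡-dec _≟ᶠ_ _≟ᶠ_ q p) {p} refl

∈point⁻ : {p q : Point n m} → ⟦ point p ⟧ q → q ≡ p
∈point⁻ {p = p} {q} = ∈comprehension⁻ (λ q → ≡-dec _≟ᶠ_ _≟ᶠ_ q p) {q}

∈×Y⁺ : ∀ {x} {y : Fin m} (W : Subset n) → x ∈ˢ W → y ∈ˢ (W ×Y) x
∈×Y⁺ {x = x} W x∈W rewrite dec-true (x ∈? W) x∈W = ∈⊤

∈×Y⁻ : ∀ {x} {y : Fin m} (W : Subset n) → y ∈ˢ (W ×Y) x → x ∈ˢ W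
∈×Y⁻ {x = x} W y∈ with x ∈? W
... | yes x∈W = x∈W
... | no _    = contradiction y∈ ∉⊥

∈graph⁺ : ∀ (F : Mapping n m) {x y} → x ∈ˢ dom F → y ∈ˢ val F x → y ∈ˢ graph F x
∈graph⁺ F x∈ y∈ = x∈p∩q⁺ (y∈ , ∈×Y⁺ (dom F) x∈)

∈graph⇒∈dom : ∀ (F : Mapping n m) {x y} → y ∈ˢ graph F x → x ∈ˢ dom F
∈graph⇒∈dom F {x} y∈ = ∈×Y⁻ (dom F) (proj₂ (x∈p∩q⁻ (val F x) _ y∈))

∈graph⇒∈val : ∀ (F : Mapping n m) {x y} → y ∈ˢ graph F x → y ∈ˢ val F x
∈graph⇒∈val F {x} y∈ = proj₁ (x∈p∩q⁻ (val F x) _ y∈)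

-- Membership in the sets of points defined by comprehension is read off from the
-- predicates that define them.

∈⋃? : (D : Subset n) (H : Family n m) →
      Decidable₁ λ p → ∃[ V ] (Nonempty V × V ⊆ D × ⟦ H V ⟧ p)
∈⋃? D H (x , y) = anySubset? λ V → nonempty? V ×-dec (V ⊆? D) ×-dec (y ∈? H V x)

∈⋃⁺ : (H : Family n m) {D V : Subset n} → Nonempty V → V ⊆ D → ⟦ H V ⟧ ⊆ᵖ ⟦ ⋃⟨ D ⟩ H ⟧
∈⋃⁺ H {D} {V} ne V⊆D {p} p∈ = ∈comprehension⁺ (∈⋃? D H) {p} (V , ne , V⊆D , p∈)

∈⋃⁻ : (H : Family n m) {D : Subset n} {p : Point n m} → ⟦ ⋃⟨ D ⟩ H ⟧ p →
      ∃[ V ] (Nonempty V × V ⊆ D × ⟦ H V ⟧ p)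
∈⋃⁻ H {D} {p} p∈ = ∈comprehension⁻ (∈⋃? D H) {p} p∈

♯-subadditive : (A B C : PointSet n m) → ⟦ A ⟧ ⊆ᵖ ⟦ B ∪ᵖ C ⟧ → ♯ A ≤ ♯ B + ♯ C
♯-subadditive {zero}  A B C A⊆ = z≤n
♯-subadditive {suc n} A B C A⊆ = begin
  ∣ A zero ∣ + ♯ (A ∘ suc)
    ≤⟨ +-mono-≤ (≤-trans (p⊆q⇒∣p∣≤∣q∣ (λ {y} → A⊆ {zero , y})) (∣p∪q∣≤∣p∣+∣q∣ (B zero) (C zero)))
                (♯-subadditive (A ∘ suc) (B ∘ suc) (C ∘ suc) λ { {x , y} → A⊆ {suc x , y} }) ⟩
  (∣ B zero ∣ + ∣ C zero ∣) + (♯ (B ∘ suc) + ♯ (C ∘ suc))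
    ≡⟨ interchange ∣ B zero ∣ ∣ C zero ∣ (♯ (B ∘ suc)) (♯ (C ∘ suc)) ⟩
  (∣ B zero ∣ + ♯ (B ∘ suc)) + (∣ C zero ∣ + ♯ (C ∘ suc)) ∎
  where open ≤-Reasoning

∣W∣≤♯A : (W : Subset n) (A : PointSet n m) → (∀ {x} → x ∈ˢ W → Nonempty (A x)) → ∣ W ∣ ≤ ♯ A
∣W∣≤♯A []            A covers = z≤n
∣W∣≤♯A (outside ∷ W) A covers =
  +-mono-≤ (z≤n {∣ A zero ∣}) (∣W∣≤♯A W (A ∘ suc) (covers ∘ there))
∣W∣≤♯A (inside  ∷ W) A covers =
  +-mono-≤ (nonempty⇒1≤∣p∣ (covers here)) (∣W∣≤♯A W (A ∘ suc) (covers ∘ there))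

-- Every fibre of A has at most one element.
SingleValued : PointSet n m → Set
SingleValued A = ∀ {x y y′} → y ∈ˢ A x → y′ ∈ˢ A x → y ≡ y′

♯A≤∣W∣ : (W : Subset n) (A : PointSet n m) → ⟦ A ⟧ ⊆ᵖ ⟦ W ×Y ⟧ → SingleValued A → ♯ A ≤ ∣ W ∣
♯A≤∣W∣ []      A A⊆ unique = z≤n
♯A≤∣W∣ (b ∷ W) A A⊆ unique = bound b λ y∈ → ∈×Y⁻ (b ∷ W) (A⊆ {zero , _} y∈)
  where
  rest : ♯ (A ∘ suc) ≤ ∣ W ∣
  rest = ♯A≤∣W∣ W (A ∘ suc)
    (λ { {x , y} y∈ → ∈×Y⁺ {x = x} W (drop-there (∈×Y⁻ {x = suc x} (b ∷ W) (A⊆ {suc x , y} y∈))) }) unique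
  bound : ∀ b → (∀ {y} → y ∈ˢ A zero → zero ∈ˢ b ∷ W) → ♯ A ≤ ∣ b ∷ W ∣
  bound inside  _  = +-mono-≤ (subsingleton⇒∣p∣≤1 unique) rest
  bound outside 0∈ = +-mono-≤ (empty⇒∣p∣≤0 λ { (y , y∈) → contradiction (0∈ y∈) λ () }) rest

1≤♯A⇒nonempty : (A : PointSet n m) → 1 ≤ ♯ A → ∃ ⟦ A ⟧
1≤♯A⇒nonempty {n} A 1≤♯A with any? (λ x → nonempty? (A x))
... | yes (x , y , y∈) = (x , y) , y∈
... | no ¬ne = contradiction 1≤♯A (<⇒≱ (s≤s (subst (♯ A ≤_) (∣⊥∣≡0 n)
  (♯A≤∣W∣ ⊥ A (λ { {x , y} y∈ → contradiction (x , y , y∈) ¬ne })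
              λ y∈ _ → contradiction (_ , _ , y∈) ¬ne))))

-- Partial selections

module _ (Γ : SimpleGraph n) where

  open SimpleGraph Γ

  disparate-sym : {a b : Point n m} → Disparate Γ a b → Disparate Γ b a
  disparate-sym (a≢b , ¬edge) = a≢b ∘ sym , λ y≡y′ e → ¬edge (sym y≡y′) (symm e)

  ∈compl? : (A : PointSet n m) →
            Decidable₁ λ a → ∀ x′ y′ → ⟦ A ⟧ (x′ , y′) → Disparate Γ a (x′ , y′)
  ∈compl? A a = all? λ x′ → all? λ y′ → (y′ ∈? A x′) →-dec disparate? Γ a (x′ , y′)

  ∈hull? : (A : PointSet n m) →
           Decidable₁ λ a → ∃[ x′ ] ∃[ y′ ] (⟦ A ⟧ (x′ , y′) × ¬ Disparate Γ a (x′ , y′))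
  ∈hull? A a = any? λ x′ → any? λ y′ → (y′ ∈? A x′) ×-dec ¬? (disparate? Γ a (x′ , y′))

  ∈compl⁺ : (A : PointSet n m) {a : Point n m} → (∀ b → ⟦ A ⟧ b → Disparate Γ a b) →
            ⟦ compl Γ A ⟧ a
  ∈compl⁺ A {a} disp = ∈comprehension⁺ (∈compl? A) {a} λ x′ y′ y′∈ → disp (x′ , y′) y′∈

  ∈compl⁻ : (A : PointSet n m) {a b : Point n m} → ⟦ compl Γ A ⟧ a → ⟦ A ⟧ b → Disparate Γ a b
  ∈compl⁻ A {a} {x′ , y′} a∈ b∈ = ∈comprehension⁻ (∈compl? A) {a} a∈ x′ y′ b∈

  ∈hull⁺ : (A : PointSet n m) {a b : Point n m} → ⟦ A ⟧ b → ¬ Disparate Γ a b → ⟦ hull Γ A ⟧ a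
  ∈hull⁺ A {a} {x′ , y′} b∈ ¬disp = ∈comprehension⁺ (∈hull? A) {a} (x′ , y′ , b∈ , ¬disp)

  ∈hull⁻ : (A : PointSet n m) {a : Point n m} → ⟦ hull Γ A ⟧ a →
           ∃[ b ] (⟦ A ⟧ b × ¬ Disparate Γ a b)
  ∈hull⁻ A {a} a∈ =
    let x′ , y′ , b∈ , ¬disp = ∈comprehension⁻ (∈hull? A) {a} a∈ in (x′ , y′) , b∈ , ¬disp

  ∉hull⇒∈compl : (A : PointSet n m) {a : Point n m} → ¬ ⟦ hull Γ A ⟧ a → ⟦ compl Γ A ⟧ a
  ∉hull⇒∈compl A {a} a∉ = ∈compl⁺ A {a} disp
    where
    disp : ∀ b → ⟦ A ⟧ b → Disparate Γ a b
    disp b b∈ with disparate? Γ a b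
    ... | yes d = d
    ... | no ¬d = contradiction (∈hull⁺ A {a} {b} b∈ ¬d) a∉

  -- S is the graph of a disparate selection of the mapping F on its domain.
  -- Working with graphs lets selections be restricted and glued by ∩ and ∪,
  -- and makes the empty domain unproblematic when Y is empty.
  record IsSelectionGraph (F : Mapping n m) (S : PointSet n m) : Set where
    field
      inGraph      : ⟦ S ⟧ ⊆ᵖ ⟦ graph F ⟧
      disparate    : IsDisparate Γ ⟦ S ⟧
      singleValued : SingleValued S
      covers       : ∀ {x} → x ∈ˢ dom F → Nonempty (S x)

  open IsSelectionGraph

  -- F has a disparate selection on its domain.
  Selectable : Mapping n m → Set
  Selectable F = ∃ (IsSelectionGraph F)

  emptySelection : (F : Mapping n m) → Empty (dom F) → IsSelectionGraph F (λ _ → ⊥)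
  emptySelection F ∅ .inGraph y∈             = contradiction y∈ ∉⊥
  emptySelection F ∅ .disparate a b a∈       = contradiction a∈ ∉⊥
  emptySelection F ∅ .singleValued y∈        = contradiction y∈ ∉⊥
  emptySelection F ∅ .covers x∈              = contradiction (_ , x∈) ∅

  weaken : {F G : Mapping n m} {S : PointSet n m} → dom F ≡ dom G → ⟦ graph F ⟧ ⊆ᵖ ⟦ graph G ⟧ →
           IsSelectionGraph F S → IsSelectionGraph G S
  weaken dom≡ F⊆G sel .inGraph {p} y∈ = F⊆G {p} (inGraph sel {p} y∈)
  weaken dom≡ F⊆G sel .disparate      = disparate sel
  weaken dom≡ F⊆G sel .singleValued   = singleValued sel
  weaken dom≡ F⊆G sel .covers {x} x∈  = covers sel (subst (x ∈ˢ_) (sym dom≡) x∈)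

  -- Selections on two complementary parts of the domain form a selection as soon
  -- as they are disparate from each other.
  glue : {F F₁ F₂ : Mapping n m} {S₁ S₂ : PointSet n m} →
         (∀ {x} → x ∈ˢ dom F → x ∈ˢ dom F₁ ⊎ x ∈ˢ dom F₂) →
         (∀ {x} → x ∈ˢ dom F₁ → x ∉ˢ dom F₂) →
         ⟦ graph F₁ ⟧ ⊆ᵖ ⟦ graph F ⟧ → ⟦ graph F₂ ⟧ ⊆ᵖ ⟦ graph F ⟧ →
         IsSelectionGraph F₁ S₁ → IsSelectionGraph F₂ S₂ →
         (∀ a b → ⟦ S₁ ⟧ a → ⟦ S₂ ⟧ b → Disparate Γ a b) →
         IsSelectionGraph F (S₁ ∪ᵖ S₂)
  glue {F = F} {F₁} {F₂} {S₁} {S₂} cover disjoint F₁⊆F F₂⊆F sel₁ sel₂ sep = record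
    { inGraph      = λ { {x , y} y∈ → [ F₁⊆F {x , y} ∘ inGraph sel₁ {x , y}
                                      , F₂⊆F {x , y} ∘ inGraph sel₂ {x , y} ] (∪⁻ y∈) }
    ; disparate    = λ a b a∈ b∈ a≢b → disp a b (∪⁻ a∈) (∪⁻ b∈) a≢b
    ; singleValued = λ y∈ y′∈ → single (∪⁻ y∈) (∪⁻ y′∈)
    ; covers       = λ x∈ → [ (λ x∈₁ → let y , y∈ = covers sel₁ x∈₁ in y , x∈p∪q⁺ (inj₁ y∈))
                            , (λ x∈₂ → let y , y∈ = covers sel₂ x∈₂ in y , x∈p∪q⁺ (inj₂ y∈))
                            ] (cover x∈)
    }
    where
    ∪⁻ : ∀ {x y} → y ∈ˢ (S₁ ∪ᵖ S₂) x → y ∈ˢ S₁ x ⊎ y ∈ˢ S₂ x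
    ∪⁻ {x} = x∈p∪q⁻ (S₁ x) (S₂ x)
    disp : ∀ a b → ⟦ S₁ ⟧ a ⊎ ⟦ S₂ ⟧ a → ⟦ S₁ ⟧ b ⊎ ⟦ S₂ ⟧ b → a ≢ b → Disparate Γ a b
    disp a b (inj₁ a∈) (inj₁ b∈) a≢b = disparate sel₁ a b a∈ b∈ a≢b
    disp a b (inj₁ a∈) (inj₂ b∈) a≢b = sep a b a∈ b∈
    disp a b (inj₂ a∈) (inj₁ b∈) a≢b = disparate-sym {a = b} {a} (sep b a b∈ a∈)
    disp a b (inj₂ a∈) (inj₂ b∈) a≢b = disparate sel₂ a b a∈ b∈ a≢b
    ∈dom₁ : ∀ {x y} → y ∈ˢ S₁ x → x ∈ˢ dom F₁
    ∈dom₁ {x} {y} y∈ = ∈graph⇒∈dom F₁ (inGraph sel₁ {x , y} y∈)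
    ∈dom₂ : ∀ {x y} → y ∈ˢ S₂ x → x ∈ˢ dom F₂
    ∈dom₂ {x} {y} y∈ = ∈graph⇒∈dom F₂ (inGraph sel₂ {x , y} y∈)
    single : ∀ {x y y′} → y ∈ˢ S₁ x ⊎ y ∈ˢ S₂ x → y′ ∈ˢ S₁ x ⊎ y′ ∈ˢ S₂ x → y ≡ y′
    single (inj₁ y∈) (inj₁ y′∈) = singleValued sel₁ y∈ y′∈
    single (inj₁ y∈) (inj₂ y′∈) = contradiction (∈dom₂ y′∈) (disjoint (∈dom₁ y∈))
    single (inj₂ y∈) (inj₁ y′∈) = contradiction (∈dom₂ y∈) (disjoint (∈dom₁ y′∈))
    single (inj₂ y∈) (inj₂ y′∈) = singleValued sel₂ y∈ y′∈

  graph-complementMapping⊆ : (F : Mapping n m) (W : Subset n) (Z : PointSet n m) →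
                             ⟦ graph (complementMapping Γ F W Z) ⟧ ⊆ᵖ ⟦ graph F ⟧
  graph-complementMapping⊆ F W Z {x , y} y∈ = ∈graph⁺ F
    (p─q⊆p (dom F) W (∈graph⇒∈dom (complementMapping Γ F W Z) y∈))
    (proj₁ (x∈p∩q⁻ (val F x) _ (∈graph⇒∈val (complementMapping Γ F W Z) y∈)))

  graph-complementMapping-disparate :
    (F : Mapping n m) (W : Subset n) (Z : PointSet n m) {a b : Point n m} →
    ⟦ graph (complementMapping Γ F W Z) ⟧ a → ⟦ Z ⟧ b → Disparate Γ a b
  graph-complementMapping-disparate F W Z {x , y} {b} y∈ b∈ = ∈compl⁻ Z {x , y} {b}
    (proj₂ (x∈p∩q⁻ (val F x) _ (∈graph⇒∈val (complementMapping Γ F W Z) y∈))) b∈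

  pointSelection : {F : Mapping n m} {p : Point n m} → ⟦ graph F ⟧ p →
                   IsSelectionGraph (restrict F ⁅ proj₁ p ⁆) (point p)
  pointSelection {F = F} {x , y} y∈ = record
    { inGraph      = λ { {x′ , y′} q∈ → aux (∈point⁻ {p = x , y} {x′ , y′} q∈) }
    ; disparate    = λ a b a∈ b∈ a≢b → contradiction
                       (trans (∈point⁻ {p = x , y} {a} a∈) (sym (∈point⁻ {p = x , y} {b} b∈))) a≢b
    ; singleValued = λ {x′} {y₁} {y₂} y₁∈ y₂∈ → cong proj₂
                       (trans (∈point⁻ {p = x , y} {x′ , y₁} y₁∈)
                              (sym (∈point⁻ {p = x , y} {x′ , y₂} y₂∈)))
    ; covers       = λ x′∈ → y , subst (λ z → ⟦ point (x , y) ⟧ (z , y))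
                                       (sym (x∈⁅y⁆⇒x≡y x x′∈)) (∈point⁺ (x , y))
    }
    where
    aux : ∀ {q} → q ≡ (x , y) → ⟦ graph (restrict F ⁅ x ⁆) ⟧ q
    aux refl = ∈graph⁺ (restrict F ⁅ x ⁆) (x∈⁅x⁆ x) (∈graph⇒∈val F y∈)

  extendSelection : {F : Mapping n m} {p : Point n m} {S : PointSet n m} → ⟦ graph F ⟧ p →
                    IsSelectionGraph (fix Γ F p) S → IsSelectionGraph F (point p ∪ᵖ S)
  extendSelection {F = F} {p@(x , y)} {S} p∈ sel =
    glue {F = F} {restrict F ⁅ x ⁆} {fix Γ F p}
      cover
      (λ z∈ z∈′ → x∈p─q⇒x∉q (dom F) ⁅ x ⁆ z∈′ z∈)
      (λ { {x′ , y′} q∈ → ∈graph⁺ F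
             (subst (_∈ˢ dom F) (sym (x∈⁅y⁆⇒x≡y x (∈graph⇒∈dom (restrict F ⁅ x ⁆) q∈)))
                    (∈graph⇒∈dom F p∈))
             (∈graph⇒∈val (restrict F ⁅ x ⁆) q∈) })
      (λ {q} → graph-complementMapping⊆ F ⁅ x ⁆ (point p) {q})
      (pointSelection p∈) sel
      (λ a b a∈ b∈ → disparate-sym {a = b} {a}
        (graph-complementMapping-disparate F ⁅ x ⁆ (point p) {b} {a} (inGraph sel {b} b∈) a∈))
    where
    cover : ∀ {z} → z ∈ˢ dom F → z ∈ˢ ⁅ x ⁆ ⊎ z ∈ˢ dom F ─ ⁅ x ⁆
    cover {z} z∈ with z ∈? ⁅ x ⁆
    ... | yes z∈x = inj₁ z∈x
    ... | no  z∉x = inj₂ (x∈p∧x∉q⇒x∈p─q z∈ z∉x)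

-- Disparate selections yield distributed Hall collections

  -- The two branches of the recursive step of a cascade.
  stages-⊆ : ∀ (F : Mapping n m) H {W W′} Ws → W′ ⊆ W → stages Γ F H (W ∷ W′ ∷ Ws) ≡
             stage W F H ∷ stages Γ (kept Γ F H W) H (W′ ∷ Ws)
  stages-⊆ F H {W} {W′} Ws W′⊆ =
    cong (λ b → stage W F H ∷
            (if b then stages Γ (kept Γ F H W) H (W′ ∷ Ws)
                  else stages Γ (complementMapping Γ F W (graph (kept Γ F H W)))
                                (complementFamily Γ H W) (W′ ∷ Ws)))
         (dec-true (W′ ⊆? W) W′⊆)

  stages-⊈ : ∀ (F : Mapping n m) H {W W′} Ws → ¬ W′ ⊆ W → stages Γ F H (W ∷ W′ ∷ Ws) ≡
             stage W F H ∷ stages Γ (complementMapping Γ F W (graph (kept Γ F H W)))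
                                    (complementFamily Γ H W) (W′ ∷ Ws)
  stages-⊈ F H {W} {W′} Ws W′⊈ =
    cong (λ b → stage W F H ∷
            (if b then stages Γ (kept Γ F H W) H (W′ ∷ Ws)
                  else stages Γ (complementMapping Γ F W (graph (kept Γ F H W)))
                                (complementFamily Γ H W) (W′ ∷ Ws)))
         (dec-false (W′ ⊆? W) W′⊈)

  firstStage : {P : Stage n m → Set} → ∀ {F H W} Ws →
               All P (stages Γ F H (W ∷ Ws)) → P (stage W F H)
  firstStage []      (p ∷ _) = p
  firstStage (_ ∷ _) (p ∷ _) = p

  -- The trace on W of a selection through p is a selection of the mapping
  -- left on W after p is fixed.
  restrictSelection : {F : Mapping n m} {S : PointSet n m} {p : Point n m} {W : Subset n} →
    IsSelectionGraph F S → ⟦ S ⟧ p → W ⊆ dom F → proj₁ p ∉ˢ W →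
    IsSelectionGraph (restrict (fix Γ F p) W) (S ∩ᵖ (W ×Y))
  restrictSelection {F = F} {S} {p} {W} sel p∈ W⊆ x∉W = record
    { inGraph      = λ { {x , y} y∈ → ∈graph⁺ (restrict (fix Γ F p) W) (∈W y∈) (x∈p∩q⁺
        ( ∈graph⇒∈val F (inGraph sel {x , y} (∈S y∈))
        , ∈compl⁺ (point p) {x , y} λ b b∈ → subst (Disparate Γ (x , y))
            (sym (∈point⁻ {p = p} {b} b∈))
            (disparate sel (x , y) p (∈S y∈) p∈ λ { refl → x∉W (∈W y∈) }) )) }
    ; disparate    = λ a b a∈ b∈ → disparate sel a b (∈S a∈) (∈S b∈)
    ; singleValued = λ y∈ y′∈ → singleValued sel (∈S y∈) (∈S y′∈)
    ; covers       = λ x∈W → let y , y∈ = covers sel (W⊆ x∈W) in y , x∈p∩q⁺ (y∈ , ∈×Y⁺ W x∈W)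
    }
    where
    ∈S : ∀ {x y} → y ∈ˢ (S ∩ᵖ (W ×Y)) x → y ∈ˢ S x
    ∈S {x} y∈ = proj₁ (x∈p∩q⁻ (S x) _ y∈)
    ∈W : ∀ {x y} → y ∈ˢ (S ∩ᵖ (W ×Y)) x → x ∈ˢ W
    ∈W {x} y∈ = ∈×Y⁻ W (proj₂ (x∈p∩q⁻ (S x) _ y∈))

  -- Every A_V of the collection H on D lies in S over V.  This property is
  -- inherited by all collections arising along a cascade.
  Within : PointSet n m → Subset n → Family n m → Set
  Within S D H = ∀ V → Nonempty V → V ⊆ D → ⟦ H V ⟧ ⊆ᵖ ⟦ S ∩ᵖ (V ×Y) ⟧

  module _ {S : PointSet n m} (disp : IsDisparate Γ ⟦ S ⟧) (single : SingleValued S) where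

    -- No point of S outside W is in the hull of points of S over W, so only the
    -- points over W are counted, at most one for each vertex.
    within⇒distributedAt : ∀ {D H W} → Within S D H → Nonempty W → W ⊆ D →
                           IsDistributedAt Γ D H W
    within⇒distributedAt {D} {H} {W} within (w , w∈) W⊆D V _ V⊆ =
      ♯A≤∣W∣ W A (λ { {x , y} y∈ → ∈×Y⁺ W (∈W y∈) })
        (λ y∈ y′∈ → single (∈S y∈) (∈S y′∈))
      where
      A = H (W ∪ V) ∩ᵖ ((W ×Y) ∪ᵖ (hull Γ (⋃⟨ W ⟩ H) ∩ᵖ (V ×Y)))
      ∪⊆ : W ∪ V ⊆ D
      ∪⊆ x∈ = [ W⊆D , p─q⊆p D W ∘ V⊆ ] (x∈p∪q⁻ W V x∈)
      ∈S : ∀ {x y} → y ∈ˢ A x → y ∈ˢ S x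
      ∈S {x} {y} y∈ = proj₁ (x∈p∩q⁻ (S x) _
        (within (W ∪ V) (w , x∈p∪q⁺ (inj₁ w∈)) ∪⊆ {x , y} (proj₁ (x∈p∩q⁻ (H (W ∪ V) x) _ y∈))))
      ∈W : ∀ {x y} → y ∈ˢ A x → x ∈ˢ W
      ∈W {x} {y} y∈ with x∈p∪q⁻ ((W ×Y) x) _ (proj₂ (x∈p∩q⁻ (H (W ∪ V) x) _ y∈))
      ... | inj₁ y∈W×Y = ∈×Y⁻ W y∈W×Y
      ... | inj₂ y∈′ with x∈p∩q⁻ (hull Γ (⋃⟨ W ⟩ H) x) _ y∈′
      ... | y∈hull , y∈V×Y with ∈hull⁻ (⋃⟨ W ⟩ H) {x , y} y∈hull
      ... | (x′ , y′) , y′∈⋃ , ¬disp with ∈⋃⁻ H {W} {x′ , y′} y′∈⋃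
      ... | V′ , ne , V′⊆W , y′∈
        with x∈p∩q⁻ (S x′) _ (within V′ ne (W⊆D ∘ V′⊆W) {x′ , y′} y′∈)
      ... | y′∈S , y′∈V′×Y = contradiction
        (disp (x , y) (x′ , y′) (∈S y∈) y′∈S
          λ { refl → x∈p─q⇒x∉q D W (V⊆ (∈×Y⁻ {x = x} V y∈V×Y)) (V′⊆W (∈×Y⁻ {x = x} V′ y′∈V′×Y)) })
        ¬disp

    within-complementFamily : ∀ {D H W} → Within S D H → W ⊆ D →
                              Within S (D ─ W) (complementFamily Γ H W)
    within-complementFamily {D} {H} {W} within W⊆D V (v , v∈) V⊆ {x , y} y∈
      with x∈p∩q⁻ (H (W ∪ V) x) _ y∈
    ... | y∈H , y∈′ = x∈p∩q⁺
      ( proj₁ (x∈p∩q⁻ (S x) _ (within (W ∪ V) (v , x∈p∪q⁺ (inj₂ v∈)) ∪⊆ {x , y} y∈H))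
      , proj₂ (x∈p∩q⁻ (compl Γ (⋃⟨ W ⟩ H) x) _ y∈′) )
      where
      ∪⊆ : W ∪ V ⊆ D
      ∪⊆ x∈ = [ W⊆D , p─q⊆p D W ∘ V⊆ ] (x∈p∪q⁻ W V x∈)

    within⇒stagesDistributed : (Hall : Mapping n m → Set) →
      ∀ F H W Ws → Within S (dom F) H →
      All (λ σ → IsMinimalCritical Γ Hall (Stage.map σ) (Stage.set σ)) (stages Γ F H (W ∷ Ws)) →
      All (λ σ → IsDistributedAt Γ (dom (Stage.map σ)) (Stage.col σ) (Stage.set σ))
          (stages Γ F H (W ∷ Ws))
    within⇒stagesDistributed Hall F H W [] within (((ne , W⊆ , _) , _) ∷ []) =
      within⇒distributedAt within ne W⊆ ∷ []
    within⇒stagesDistributed Hall F H W (W′ ∷ Ws) within mins =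
      byCases (firstStage (W′ ∷ Ws) mins) (W′ ⊆? W)
      where
      byCases : IsMinimalCritical Γ Hall F W → Dec (W′ ⊆ W) →
        All (λ σ → IsDistributedAt Γ (dom (Stage.map σ)) (Stage.col σ) (Stage.set σ))
            (stages Γ F H (W ∷ W′ ∷ Ws))
      byCases ((ne , W⊆ , _) , _) (yes W′⊆) = subst (All _) (sym (stages-⊆ F H Ws W′⊆))
        ( within⇒distributedAt within ne W⊆
        ∷ within⇒stagesDistributed Hall (kept Γ F H W) H W′ Ws
            (λ V ne V⊆ → within V ne (W⊆ ∘ V⊆))
            (All.tail (subst (All _) (stages-⊆ F H Ws W′⊆) mins)) )
      byCases ((ne , W⊆ , _) , _) (no W′⊈) = subst (All _) (sym (stages-⊈ F H Ws W′⊈))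
        ( within⇒distributedAt within ne W⊆
        ∷ within⇒stagesDistributed Hall (complementMapping Γ F W (graph (kept Γ F H W)))
            (complementFamily Γ H W) W′ Ws (within-complementFamily within W⊆)
            (All.tail (subst (All _) (stages-⊈ F H Ws W′⊈) mins)) )

  -- On more than one vertex the collection is V ↦ S ∩ (V × Y).  The fuel k only
  -- determines the critical sets, whose nature is irrelevant here.
  selection⇒hall : ∀ k {F : Mapping n m} {S} → IsSelectionGraph F S →
                   Nonempty (dom F) → ∣ dom F ∣ ≤ k → HallUpTo Γ k F
  selection⇒hall zero sel ne ∣dom∣≤0 = contradiction ∣dom∣≤0 (<⇒≱ (nonempty⇒1≤∣p∣ ne))
  selection⇒hall (suc k) {F} {S} sel ne@(x , x∈) ∣dom∣≤1+k with ∣ dom F ∣ ≟ 1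
  ... | yes ∣dom∣≡1 =
    let y , y∈ = covers sel x∈ in inj₁ (∣dom∣≡1 , (x , y) , inGraph sel {x , y} y∈)
  ... | no ∣dom∣≢1  = inj₂
    ( ≤∧≢⇒< (nonempty⇒1≤∣p∣ ne) (∣dom∣≢1 ∘ sym)
    , H
    , record
      { inGraph   = λ { V _ V⊆ {x , y} y∈ → ∈graph⁺ (restrict F V)
                          (∈×Y⁻ V (proj₂ (x∈p∩q⁻ (S x) _ y∈)))
                          (∈graph⇒∈val F (inGraph sel {x , y} (∈S V y∈))) }
      ; disparate = λ V _ _ a b a∈ b∈ → disparate sel a b (∈S V a∈) (∈S V b∈)
      ; large     = λ V _ V⊆ → ∣W∣≤♯A V (H V) λ x∈V →
                      let y , y∈ = covers sel (V⊆ x∈V) in y , x∈p∩q⁺ (y∈ , ∈×Y⁺ V x∈V)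
      }
    , λ W Ws (_ , mins) → within⇒stagesDistributed (disparate sel) (singleValued sel)
        (HallUpTo Γ k) F H W Ws (λ V _ _ {p} p∈ → p∈) mins )
    where
    H : Family n _
    H V = S ∩ᵖ (V ×Y)
    ∈S : ∀ V {x y} → y ∈ˢ H V x → y ∈ˢ S x
    ∈S V {x} y∈ = proj₁ (x∈p∩q⁻ (S x) _ y∈)

-- Distributed Hall collections yield disparate selections

  nextComplement-⊆ : ∀ {W Wᶜ W′ : Subset n} → W′ ⊆ W → nextComplement W Wᶜ W′ ≡ W ─ W′
  nextComplement-⊆ {W} {W′ = W′} W′⊆ rewrite dec-true (W′ ⊆? W) W′⊆ = refl

  nextComplement-⊈ : ∀ {W Wᶜ W′ : Subset n} → ¬ W′ ⊆ W → nextComplement W Wᶜ W′ ≡ Wᶜ ─ W′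
  nextComplement-⊈ {W} {W′ = W′} W′⊈ rewrite dec-false (W′ ⊆? W) W′⊈ = refl

  -- The two halves into which a minimal critical set W splits the problem: a
  -- primitive critical cascade of either half, preceded by W, is one of (F , H).
  module _ (Hall : Mapping n m → Set) {F : Mapping n m} {H : Family n m}
           (dist : IsDistributed Γ Hall F H)
           {W : Subset n} (min : IsMinimalCritical Γ Hall F W) where

    private
      W⊆ : W ⊆ dom F
      W⊆ = proj₁ (proj₂ (proj₁ min))

    criticalSet⇒distributedAt : IsDistributedAt Γ (dom F) H W
    criticalSet⇒distributedAt = All.head (dist W [] ((inj₁ W⊆ , tt) , min ∷ []))

    kept-distributed : IsDistributed Γ Hall (kept Γ F H W) H
    kept-distributed W₁ Ws ((sub , cascade) , mins) =
      All.tail (subst (All _) (stages-⊆ F H Ws W₁⊆)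
        (dist W (W₁ ∷ Ws)
          ( (inj₁ W⊆ , inj₁ W₁⊆ , subst (λ C → CascadeFrom W₁ C Ws)
              (trans (nextComplement-⊆ W₁⊆) (sym (nextComplement-⊆ W₁⊆))) cascade)
          , subst (All _) (sym (stages-⊆ F H Ws W₁⊆)) (min ∷ mins) )))
      where
      W₁⊆ : W₁ ⊆ W
      W₁⊆ = reduce sub

    complement-distributed :
      IsDistributed Γ Hall (complementMapping Γ F W (graph (kept Γ F H W)))
                           (complementFamily Γ H W)
    complement-distributed W₁ Ws ((sub , cascade) , mins) =
      All.tail (subst (All _) (stages-⊈ F H Ws W₁⊈)
        (dist W (W₁ ∷ Ws)
          ( ( inj₁ W⊆
            , inj₂ (subst (W₁ ⊆_) (sym next) W₁⊆)
            , subst (λ C → CascadeFrom W₁ C Ws)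
                (trans (nextComplement-⊆ W₁⊆)
                  (trans (cong (_─ W₁) (sym next)) (sym (nextComplement-⊈ W₁⊈)))) cascade )
          , subst (All _) (sym (stages-⊈ F H Ws W₁⊈)) (min ∷ mins) )))
      where
      W₁⊆ : W₁ ⊆ dom F ─ W
      W₁⊆ = reduce sub
      next : nextComplement (dom F) (dom F) W ≡ dom F ─ W
      next = nextComplement-⊆ W⊆
      -- W₁ is critical, hence nonempty, and disjoint from W.
      W₁⊈ : ¬ W₁ ⊆ W
      W₁⊈ W₁⊆W = let w , w∈ = proj₁ (proj₁ (firstStage Ws mins)) in
        x∈p─q⇒x∉q (dom F) W (W₁⊆ w∈) (W₁⊆W w∈)

  -- H restricted to W is a Hall collection of F^{H_W}; if H is W-distributed, then
  -- H_W is one of the complementary mapping.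
  module _ {F : Mapping n m} {H : Family n m} (hall : IsHallCollection Γ F H)
           {W : Subset n} (neW : Nonempty W) (W⊆ : W ⊆ dom F) where

    open IsHallCollection hall renaming (inGraph to hall-inGraph; disparate to hall-disparate)

    private
      Hᶜ : Family n m
      Hᶜ = complementFamily Γ H W

      G̃ : PointSet n m
      G̃ = graph (kept Γ F H W)

      ∪⊆ : ∀ {V} → V ⊆ dom F ─ W → W ∪ V ⊆ dom F
      ∪⊆ {V} V⊆ x∈ = [ W⊆ , p─q⊆p (dom F) W ∘ V⊆ ] (x∈p∪q⁻ W V x∈)

      ∪ne : ∀ {V} → Nonempty (W ∪ V)
      ∪ne = let w , w∈ = neW in w , x∈p∪q⁺ (inj₁ w∈)

      ∈Hᶜ⁻ : ∀ V {x y} → y ∈ˢ Hᶜ V x →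
             y ∈ˢ H (W ∪ V) x × y ∈ˢ compl Γ (⋃⟨ W ⟩ H) x × x ∈ˢ V
      ∈Hᶜ⁻ V {x} y∈ with x∈p∩q⁻ (H (W ∪ V) x) _ y∈
      ... | y∈H , y∈′ with x∈p∩q⁻ (compl Γ (⋃⟨ W ⟩ H) x) _ y∈′
      ... | y∈compl , y∈V×Y = y∈H , y∈compl , ∈×Y⁻ V y∈V×Y

    kept-isHallCollection : IsHallCollection Γ (kept Γ F H W) H
    kept-isHallCollection = record
      { inGraph   = λ { V ne V⊆ {x , y} y∈ →
          let y∈F = hall-inGraph V ne (W⊆ ∘ V⊆) {x , y} y∈ in
          ∈graph⁺ (restrict (kept Γ F H W) V) (∈graph⇒∈dom (restrict F V) y∈F)
            (x∈p∩q⁺ ( ∈graph⇒∈val (restrict F V) y∈F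
                    , ∈compl⁺ (⋃⟨ dom F ─ W ⟩ Hᶜ) {x , y} λ b b∈ →
                        disp {x , y} {b} (∈⋃⁺ H ne V⊆ {x , y} y∈) b∈ )) }
      ; disparate = λ V ne V⊆ → hall-disparate V ne (W⊆ ∘ V⊆)
      ; large     = λ V ne V⊆ → large V ne (W⊆ ∘ V⊆)
      }
      where
      disp : ∀ {a b} → ⟦ ⋃⟨ W ⟩ H ⟧ a → ⟦ ⋃⟨ dom F ─ W ⟩ Hᶜ ⟧ b → Disparate Γ a b
      disp {a} {b} a∈ b∈ with ∈⋃⁻ Hᶜ {p = b} b∈
      ... | V , _ , _ , b∈Hᶜ =
        disparate-sym {a = b} {a}
          (∈compl⁻ (⋃⟨ W ⟩ H) {b} {a} (proj₁ (proj₂ (∈Hᶜ⁻ V b∈Hᶜ))) a∈)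

    complement-isHallCollection : IsDistributedAt Γ (dom F) H W →
      IsHallCollection Γ (complementMapping Γ F W G̃) Hᶜ
    complement-isHallCollection distAt = record
      { inGraph   = λ { V ne V⊆ {x , y} y∈ →
          let y∈H , _ , x∈V = ∈Hᶜ⁻ V y∈
              y∈F = ∈graph⇒∈val (restrict F (W ∪ V)) (hall-inGraph _ ∪ne (∪⊆ V⊆) {x , y} y∈H)
          in ∈graph⁺ (restrict (complementMapping Γ F W G̃) V) x∈V
               (x∈p∩q⁺ (y∈F , ∈compl⁺ G̃ {x , y} λ b b∈ → disparate-sym {a = b} {x , y}
                 (kept-disparate {b} {x , y} b∈ (∈⋃⁺ Hᶜ ne V⊆ {x , y} y∈)))) }
      ; disparate = λ V ne V⊆ a b a∈ b∈ → hall-disparate _ ∪ne (∪⊆ V⊆) a b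
                      (proj₁ (∈Hᶜ⁻ V a∈)) (proj₁ (∈Hᶜ⁻ V b∈))
      ; large     = largeᶜ
      }
      where
      kept-disparate : ∀ {b a} → ⟦ G̃ ⟧ b → ⟦ ⋃⟨ dom F ─ W ⟩ Hᶜ ⟧ a → Disparate Γ b a
      kept-disparate {x , y} {a} b∈ = ∈compl⁻ (⋃⟨ dom F ─ W ⟩ Hᶜ) {x , y} {a}
        (proj₂ (x∈p∩q⁻ (val F x) _ (∈graph⇒∈val (kept Γ F H W) b∈)))
      -- Of the at least |W| + |V| points of the set indexed by W ∪ V, at most
      -- |W| are lost.
      largeᶜ : ∀ V → Nonempty V → V ⊆ dom F ─ W → ∣ V ∣ ≤ ♯ (Hᶜ V)
      largeᶜ V ne V⊆ = +-cancelˡ-≤ ∣ W ∣ _ _ $ begin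
        ∣ W ∣ + ∣ V ∣    ≤⟨ ∣p∣+∣q∣≤∣p∪q∣ W V (λ x∈W x∈V → x∈p─q⇒x∉q (dom F) W (V⊆ x∈V) x∈W) ⟩
        ∣ W ∪ V ∣        ≤⟨ large _ ∪ne (∪⊆ V⊆) ⟩
        ♯ (H (W ∪ V))    ≤⟨ ♯-subadditive (H (W ∪ V)) lost (Hᶜ V) split ⟩
        ♯ lost + ♯ (Hᶜ V) ≤⟨ +-monoˡ-≤ _ (distAt V ne V⊆) ⟩
        ∣ W ∣ + ♯ (Hᶜ V) ∎
        where
        open ≤-Reasoning
        lost = H (W ∪ V) ∩ᵖ ((W ×Y) ∪ᵖ (hull Γ (⋃⟨ W ⟩ H) ∩ᵖ (V ×Y)))
        split : ⟦ H (W ∪ V) ⟧ ⊆ᵖ ⟦ lost ∪ᵖ Hᶜ V ⟧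
        split {x , y} y∈
          with x∈p∪q⁻ W V (∈graph⇒∈dom (restrict F (W ∪ V))
                            (hall-inGraph _ ∪ne (∪⊆ V⊆) {x , y} y∈))
        ... | inj₁ x∈W = x∈p∪q⁺ (inj₁ (x∈p∩q⁺ (y∈ , x∈p∪q⁺ (inj₁ (∈×Y⁺ W x∈W)))))
        ... | inj₂ x∈V with y ∈? hull Γ (⋃⟨ W ⟩ H) x
        ...   | yes y∈hull = x∈p∪q⁺ (inj₁ (x∈p∩q⁺
                (y∈ , x∈p∪q⁺ (inj₂ (x∈p∩q⁺ (y∈hull , ∈×Y⁺ V x∈V))))))
        ...   | no  y∉hull = x∈p∪q⁺ (inj₂ (x∈p∩q⁺
                (y∈ , x∈p∩q⁺ (∉hull⇒∈compl (⋃⟨ W ⟩ H) {x , y} y∉hull , ∈×Y⁺ V x∈V))))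

  kept⊆ : (F : Mapping n m) (H : Family n m) {W : Subset n} → W ⊆ dom F →
          ⟦ graph (kept Γ F H W) ⟧ ⊆ᵖ ⟦ graph F ⟧
  kept⊆ F H {W} W⊆ {x , y} y∈ = ∈graph⁺ F (W⊆ (∈graph⇒∈dom (kept Γ F H W) y∈))
    (proj₁ (x∈p∩q⁻ (val F x) _ (∈graph⇒∈val (kept Γ F H W) y∈)))

  glueKept : (F : Mapping n m) (H : Family n m) {W : Subset n} → W ⊆ dom F →
             Selectable (kept Γ F H W) →
             Selectable (complementMapping Γ F W (graph (kept Γ F H W))) → Selectable F
  glueKept F H {W} W⊆ (S₁ , sel₁) (S₂ , sel₂) = S₁ ∪ᵖ S₂ ,
    glue {F = F} {kept Γ F H W} {complementMapping Γ F W G̃}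
      cover (λ x∈W x∈ → x∈p─q⇒x∉q (dom F) W x∈ x∈W)
      (λ {p} → kept⊆ F H W⊆ {p}) (λ {p} → graph-complementMapping⊆ F W G̃ {p})
      sel₁ sel₂
      (λ a b a∈ b∈ → disparate-sym {a = b} {a}
        (graph-complementMapping-disparate F W G̃ {b} {a} (inGraph sel₂ {b} b∈) (inGraph sel₁ {a} a∈)))
    where
    G̃ = graph (kept Γ F H W)
    cover : ∀ {x} → x ∈ˢ dom F → x ∈ˢ W ⊎ x ∈ˢ dom F ─ W
    cover {x} x∈ with x ∈? W
    ... | yes x∈W = inj₁ x∈W
    ... | no  x∉W = inj₂ (x∈p∧x∉q⇒x∈p─q x∈ x∉W)

  noMinimal⇒noCritical : (Hall : Mapping n m → Set) (F : Mapping n m) →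
    (∀ W → ¬ IsMinimalCritical Γ Hall F W) → ∀ W → ¬ IsCritical Γ Hall F W
  noMinimal⇒noCritical Hall F noMin W = go W (⊂-wellFounded W)
    where
    go : ∀ W → Acc _⊂_ W → ¬ IsCritical Γ Hall F W
    go W (acc rs) crit = noMin W (crit , λ W′ W′⊂W → go W′ (rs W′⊂W))

  -- The inductive step of sufficiency.  The predicate Hall, which determines the
  -- critical sets, stays fixed while the domain shrinks; it only has to imply
  -- selectability on at most k vertices.
  distributed⇒selectable : (Hall : Mapping n m → Set) (k : ℕ) →
    (∀ G → ∣ dom G ∣ ≤ k → Hall G → ¬ ¬ Selectable G) →
    ∀ F H → ∣ dom F ∣ ≤ suc k → IsHallCollection Γ F H → IsDistributed Γ Hall F H →
    ¬ ¬ Selectable F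
  distributed⇒selectable {m} Hall k sound F H = go F H (⊂-wellFounded (dom F))
    where
    go : ∀ F H → Acc _⊂_ (dom F) → ∣ dom F ∣ ≤ suc k → IsHallCollection Γ F H →
         IsDistributed Γ Hall F H → ¬ ¬ Selectable F
    go F H (acc rs) ∣dom∣≤ hall dist ¬sel with nonempty? (dom F)
    ... | no ∅   = ¬sel (_ , emptySelection F ∅)
    ... | yes ne = noCrit W
      (neW , p─q⊆p (dom F) ⁅ x ⁆ , x , y , x∈p⇒x∈p─[p─⁅x⁆] (dom F) x∈ , λ hallW →
        sound (fix Γ F p)
              (≤-pred (≤-trans (p⊂q⇒∣p∣<∣q∣ (p─⁅x⁆⊂p (dom F) x∈)) ∣dom∣≤))
              hallW ¬selFix)
      where
      -- A minimal critical set W would split F into two mappings on smaller domains.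
      noMin : ∀ W → ¬ IsMinimalCritical Γ Hall F W
      noMin W min@((neW@(w , w∈) , W⊆ , x , _ , x∈ , _) , _) =
        go (kept Γ F H W) H (rs W⊂)
          (≤-trans (p⊆q⇒∣p∣≤∣q∣ W⊆) ∣dom∣≤)
          (kept-isHallCollection hall neW W⊆)
          (kept-distributed Hall dist min) λ sel₁ →
        go (complementMapping Γ F W (graph (kept Γ F H W))) (complementFamily Γ H W)
          (rs ─⊂) (≤-trans (p⊆q⇒∣p∣≤∣q∣ (proj₁ ─⊂)) ∣dom∣≤)
          (complement-isHallCollection hall neW W⊆ (criticalSet⇒distributedAt Hall dist min))
          (complement-distributed Hall dist min) λ sel₂ →
        ¬sel (glueKept F H W⊆ sel₁ sel₂)
        where
        W⊂ : W ⊂ dom F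
        W⊂ = W⊆ , x , p─q⊆p (dom F) W x∈ , x∈p─q⇒x∉q (dom F) W x∈
        ─⊂ : dom F ─ W ⊂ dom F
        ─⊂ = p∩q≢∅⇒p─q⊂p (dom F) W (w , x∈p∩q⁺ (W⊆ w∈ , w∈))
      noCrit : ∀ W → ¬ IsCritical Γ Hall F W
      noCrit = noMinimal⇒noCritical Hall F noMin
      somePoint : ∃ ⟦ graph F ⟧
      somePoint =
        let (x , y) , y∈ = 1≤♯A⇒nonempty (H (dom F))
              (≤-trans (nonempty⇒1≤∣p∣ ne) (IsHallCollection.large hall (dom F) ne (λ x∈ → x∈)))
        in (x , y) , IsHallCollection.inGraph hall (dom F) ne (λ x∈ → x∈) {x , y} y∈
      p : Point n m
      p = proj₁ somePoint
      x = proj₁ p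
      y = proj₂ p
      x∈ : x ∈ˢ dom F
      x∈ = ∈graph⇒∈dom F (proj₂ somePoint)
      W : Subset n
      W = dom F ─ ⁅ x ⁆
      ¬selFix : ¬ Selectable (fix Γ F p)
      ¬selFix (S , sel) = ¬sel (_ , extendSelection (proj₂ somePoint) sel)
      neW : Nonempty W
      neW with nonempty? W
      ... | yes ne = ne
      ... | no ∅   = contradiction (_ , emptySelection (fix Γ F p) ∅) ¬selFix

  hall⇒selectable : ∀ k (F : Mapping n m) → ∣ dom F ∣ ≤ k → HallUpTo Γ k F → ¬ ¬ Selectable F
  hall⇒selectable (suc k) F _ (inj₁ (∣dom∣≡1 , (x , y) , y∈)) ¬sel =
    ¬sel (_ , extendSelection y∈ (emptySelection (fix Γ F (x , y))
      (∣p∣≤1⇒p─⁅x⁆-empty (dom F) (≤-reflexive ∣dom∣≡1) (∈graph⇒∈dom F y∈))))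
  hall⇒selectable (suc k) F ∣dom∣≤ (inj₂ (_ , H , hall , dist)) =
    distributed⇒selectable (HallUpTo Γ k) k (hall⇒selectable k) F H ∣dom∣≤ hall dist

-- Calculation Method 1

  -- A point p of a selection S is never eliminated: S witnesses that the mapping
  -- left on W after p is fixed satisfies the generalized Hall condition.
  elimination-preserves : {P Q : Mapping n m} {S : PointSet n m} {W : Subset n} →
    IsEliminationSet Γ P W → IsElimination Γ P W Q →
    IsSelectionGraph P S → IsSelectionGraph Q S
  elimination-preserves {P = P} {S = S} {W} (neW , W⊆ , _) (dom≡ , graph⇔) sel = record
    { inGraph      = λ {p} p∈ → Equivalence.from (graph⇔ p)
        (inGraph sel {p} p∈ , λ (p∈P , ¬hall) → ¬hall
          (selection⇒hall ∣ W ∣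
            (restrictSelection {p = p} sel p∈ W⊆
              (x∈p─q⇒x∉q (dom P) W (∈graph⇒∈dom (restrict P (dom P ─ W)) p∈P)))
            neW ≤-refl))
    ; disparate    = disparate sel
    ; singleValued = singleValued sel
    ; covers       = λ {x} x∈ → covers sel (subst (x ∈ˢ_) dom≡ x∈)
    }

  method1-preserves : {P K : Mapping n m} {S : PointSet n m} → Method1 Γ P (atStep3 K) →
                      IsSelectionGraph P S → IsSelectionGraph K S
  method1-preserves (stop3 _)              sel = sel
  method1-preserves (loop W Q set el _ r) sel =
    method1-preserves r (elimination-preserves set el sel)

  selection⇒notStep5 : {P : Mapping n m} {S : PointSet n m} → Method1 Γ P atStep5 →
                       ¬ IsSelectionGraph P S
  selection⇒notStep5 (stop5 W Q set el (x , x∈ , ∅)) sel =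
    let selQ   = elimination-preserves set el sel
        y , y∈ = covers selQ x∈
    in ∅ (y , ∈graph⇒∈val Q (inGraph selQ {x , y} y∈))
  selection⇒notStep5 (loop W Q set el _ r) sel =
    selection⇒notStep5 r (elimination-preserves set el sel)

  method1-shrinks : {P K : Mapping n m} → Method1 Γ P (atStep3 K) →
                    dom K ≡ dom P × ⟦ graph K ⟧ ⊆ᵖ ⟦ graph P ⟧
  method1-shrinks (stop3 _) = refl , λ p∈ → p∈
  method1-shrinks (loop W Q _ (dom≡ , graph⇔) _ r) =
    let dom≡′ , K⊆Q = method1-shrinks r
    in trans dom≡′ dom≡ , λ {p} p∈ → proj₁ (Equivalence.to (graph⇔ p) (K⊆Q {p} p∈))

  method1-exhausts : {P K : Mapping n m} → Method1 Γ P (atStep3 K) →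
                     ¬ (∃[ W ] IsEliminationSet Γ K W)
  method1-exhausts (stop3 ¬set)       = ¬set
  method1-exhausts (loop _ _ _ _ _ r) = method1-exhausts r

  -- In a mapping without elimination sets every point of the graph lies on a
  -- disparate selection: otherwise the complement of its vertex would be an
  -- elimination set.
  noElimination⇒fixSelectable : {K : Mapping n m} {p : Point n m} →
    ¬ (∃[ W ] IsEliminationSet Γ K W) → ⟦ graph K ⟧ p → ¬ ¬ Selectable (fix Γ K p)
  noElimination⇒fixSelectable {K = K} {p@(x , y)} ¬set p∈ ¬sel with nonempty? (dom K ─ ⁅ x ⁆)
  ... | no ∅   = ¬sel (_ , emptySelection (fix Γ K p) ∅)
  ... | yes ne = ¬set
    ( W , ne , p─q⊆p (dom K) ⁅ x ⁆ , p
    , ∈graph⁺ (restrict K (dom K ─ W)) (x∈p⇒x∈p─[p─⁅x⁆] (dom K) (∈graph⇒∈dom K p∈))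
              (∈graph⇒∈val K p∈)
    , λ hall → hall⇒selectable ∣ W ∣ (fix Γ K p) ≤-refl hall ¬sel )
    where
    W = dom K ─ ⁅ x ⁆

-- Calculation Method 2

  -- Selectability matters only before the first choice; afterwards it holds again
  -- by exhaustion of elimination sets.
  selectable⇒notStep3 : ∀ {i} {F : Mapping n m} → ¬ ¬ Selectable F →
                        (r : Method2From Γ i F) → ¬ StopsAtStep3 Γ r
  selectable⇒notStep3 ¬¬sel (stop3 r₁) _ = ¬¬sel λ (_ , sel) → selection⇒notStep5 r₁ sel
  selectable⇒notStep3 ¬¬sel (loop K p r₁ p∈ _ r) =
    selectable⇒notStep3 (noElimination⇒fixSelectable (method1-exhausts r₁) p∈) r

  step3-or-step5 : ∀ {i} {F : Mapping n m} (r : Method2From Γ i F) →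
                   ¬ StopsAtStep3 Γ r → StopsAtStep5 Γ r
  step3-or-step5 (stop3 _)          ¬3 = contradiction tt ¬3
  step3-or-step5 (stop5 _ _ _ _ _)  ¬3 = tt
  step3-or-step5 (loop _ _ _ _ _ r) ¬3 = step3-or-step5 r ¬3

  step5⇒notStep3 : ∀ {i} {F : Mapping n m} (r : Method2From Γ i F) →
                   StopsAtStep5 Γ r → ¬ StopsAtStep3 Γ r
  step5⇒notStep3 (stop5 _ _ _ _ _)  s5 = λ ()
  step5⇒notStep3 (loop _ _ _ _ _ r) s5 = step5⇒notStep3 r s5

  -- The set of the points in a list.
  points : List (Point n m) → PointSet n m
  points = foldr (λ p A → point p ∪ᵖ A) (λ _ → ⊥)

  ∈points⁺ : ∀ {q : Point n m} ps → q ∈ ps → ⟦ points ps ⟧ q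
  ∈points⁺ (p ∷ ps) (here refl) = x∈p∪q⁺ (inj₁ (∈point⁺ p))
  ∈points⁺ (p ∷ ps) (there q∈)  = x∈p∪q⁺ (inj₂ (∈points⁺ ps q∈))

  ∈points⁻ : ∀ {q : Point n m} ps → ⟦ points ps ⟧ q → q ∈ ps
  ∈points⁻ [] q∈ = contradiction q∈ ∉⊥
  ∈points⁻ {q = q} (p ∷ ps) q∈ with x∈p∪q⁻ (point p (proj₁ q)) _ q∈
  ... | inj₁ q∈p  = here (∈point⁻ {p = p} {q} q∈p)
  ... | inj₂ q∈ps = there (∈points⁻ ps q∈ps)

  -- The bound holds initially, where i = 1 and the domain is X, and persists
  -- because each round removes a vertex; at Step 5 it leaves a single vertex.
  step5⇒chosenSelection : ∀ {i} {F : Mapping n m} (r : Method2From Γ i F) → StopsAtStep5 Γ r →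
    ∣ dom F ∣ + i ≤ suc n → iMax Γ r ≡ n × IsSelectionGraph F (points (chosen Γ r))
  step5⇒chosenSelection {F = F} (stop5 K p r₁ p∈ refl) s5 bound = refl ,
    weaken dom≡ (λ {q} → K⊆F {q}) (extendSelection p∈ (emptySelection (fix Γ K p)
      (∣p∣≤1⇒p─⁅x⁆-empty (dom K)
        (subst (λ D → ∣ D ∣ ≤ 1) (sym dom≡) (+-cancelʳ-≤ n _ 1 bound)) (∈graph⇒∈dom K p∈))))
    where
    dom≡ = proj₁ (method1-shrinks r₁)
    K⊆F : ⟦ graph K ⟧ ⊆ᵖ ⟦ graph F ⟧
    K⊆F {q} = proj₂ (method1-shrinks r₁) {q}
  step5⇒chosenSelection {i = i} {F} (loop K p r₁ p∈ _ r) s5 bound =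
    let iMax≡n , sel = step5⇒chosenSelection r s5 bound′
    in iMax≡n , weaken dom≡ (λ {q} → K⊆F {q}) (extendSelection p∈ sel)
    where
    dom≡ = proj₁ (method1-shrinks r₁)
    K⊆F : ⟦ graph K ⟧ ⊆ᵖ ⟦ graph F ⟧
    K⊆F {q} = proj₂ (method1-shrinks r₁) {q}
    bound′ : ∣ dom K ─ ⁅ proj₁ p ⁆ ∣ + suc i ≤ suc n
    bound′ = begin
      ∣ dom K ─ ⁅ proj₁ p ⁆ ∣ + suc i ≡⟨ +-suc _ i ⟩
      suc ∣ dom K ─ ⁅ proj₁ p ⁆ ∣ + i
        ≤⟨ +-monoˡ-≤ i (p⊂q⇒∣p∣<∣q∣ (p─⁅x⁆⊂p (dom K) (∈graph⇒∈dom K p∈))) ⟩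
      ∣ dom K ∣ + i                   ≡⟨ cong (λ D → ∣ D ∣ + i) dom≡ ⟩
      ∣ dom F ∣ + i                   ≤⟨ bound ⟩
      suc n                           ∎
      where open ≤-Reasoning

-- Selections as functions and as graphs

  disparateSelection⇒selectable : (F : Fin n → Subset m) →
    (∃[ s ] IsDisparateSelection Γ F s) → Selectable (total F)
  disparateSelection⇒selectable F (s , s∈F , disp) = comprehension S? , record
    { inGraph      = λ { {x , y} y∈ → ∈graph⁺ (total F) ∈⊤
                           (subst (_∈ˢ F x) (sym (∈S⁻ {x , y} y∈)) (s∈F x)) }
    ; disparate    = λ a b a∈ b∈ → disp a b (∈S⁻ {a} a∈) (∈S⁻ {b} b∈)
    ; singleValued = λ {x} {y} {y′} y∈ y′∈ → trans (∈S⁻ {x , y} y∈) (sym (∈S⁻ {x , y′} y′∈))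
    ; covers       = λ {x} _ → s x , ∈comprehension⁺ S? {x , s x} refl
    }
    where
    S? : Decidable₁ {A = Point n _} λ (x , y) → y ≡ s x
    S? (x , y) = y ≟ᶠ s x
    ∈S⁻ : ⟦ comprehension S? ⟧ ⊆ᵖ λ (x , y) → y ≡ s x
    ∈S⁻ {p} = ∈comprehension⁻ S? {p}

  selectionGraph⇒disparateSelection : (F : Fin n → Subset m) {S : PointSet n m} →
    IsSelectionGraph (total F) S →
    ∃[ s ] (IsDisparateSelection Γ F s × (∀ x y → (y ≡ s x) ⇔ (y ∈ˢ S x)))
  selectionGraph⇒disparateSelection F {S} sel = s , (s∈F , disp) , λ x y →
      mk⇔ (λ { refl → s∈S x }) (λ y∈ → singleValued sel y∈ (s∈S x))
    where
    s : Fin n → Fin _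
    s x = proj₁ (covers sel {x} ∈⊤)
    s∈S : ∀ x → s x ∈ˢ S x
    s∈S x = proj₂ (covers sel {x} ∈⊤)
    s∈F : IsSelection Γ F s
    s∈F x = ∈graph⇒∈val (total F) (inGraph sel {x , s x} (s∈S x))
    disp : IsDisparate Γ (λ (x , y) → y ≡ s x)
    disp (x , _) (x′ , _) refl refl = disparate sel (x , s x) (x′ , s x′) (s∈S x) (s∈S x′)

theorem11p3 : ∀ {n m : ℕ} (Γ : SimpleGraph n) (F : Fin n → Subset m) (r : Method2 Γ F) →
    ((∃[ s ] IsDisparateSelection Γ F s) ⇔ (¬ StopsAtStep3 Γ r)) ×
    ((¬ StopsAtStep3 Γ r) ⇔ StopsAtStep5 Γ r) ×
    (StopsAtStep5 Γ r ⇔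
    (iMax Γ r ≡ n ×
    (∃[ s ] (IsDisparateSelection Γ F s × (∀ x y → (y ≡ s x) ⇔ ((x , y) ∈ chosen Γ r))))))
theorem11p3 {n} {m} Γ F r =
    mk⇔ i⇒ii (λ ¬3 → let _ , s , sel , _ = iii⇒iv (step3-or-step5 Γ r ¬3) in s , sel)
  , mk⇔ (step3-or-step5 Γ r) (step5⇒notStep3 Γ r)
  , mk⇔ iii⇒iv (λ (_ , s , sel , _) → step3-or-step5 Γ r (i⇒ii (s , sel)))
  where
  i⇒ii : (∃[ s ] IsDisparateSelection Γ F s) → ¬ StopsAtStep3 Γ r
  i⇒ii s = selectable⇒notStep3 Γ (λ ¬sel → ¬sel (disparateSelection⇒selectable Γ F s)) r
  iii⇒iv : StopsAtStep5 Γ r → iMax Γ r ≡ n ×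
    (∃[ s ] (IsDisparateSelection Γ F s × (∀ x y → (y ≡ s x) ⇔ ((x , y) ∈ chosen Γ r))))
  iii⇒iv s5 =
    let ∣dom∣+1≤      = ≤-reflexive (trans (cong (_+ 1) (∣⊤∣≡n n)) (+-comm n 1))
        iMax≡n , sel  = step5⇒chosenSelection Γ r s5 ∣dom∣+1≤
        s , isSel , ⇔S = selectionGraph⇒disparateSelection Γ F sel
    in iMax≡n , s , isSel , λ x y → mk⇔
         (∈points⁻ Γ (chosen Γ r) ∘ Equivalence.to (⇔S x y))
         (Equivalence.from (⇔S x y) ∘ ∈points⁺ Γ (chosen Γ r))
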